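{- Fix a UL-chain $\mathbf{A}$ and a predicate language $\mathcal{P}$, and let $\mathscr{K}$ be a countable class of finitely generated $\mathbf{A}$-structures for $\mathcal{P}$ (classes being considered up to isomorphism). Then $\mathscr{K}=\mathrm{Age}(\mathbf{A},\mathbf{N})$ for some $\mathbf{A}$-structure $\langle \mathbf{A},\mathbf{N}\rangle$ if and only if $\mathscr{K}$ satisfies the hereditary property (HP) and the joint embedding property (JEP). Furthermore, if $\mathscr{K}$ is a class of $\mathbf{A}$-structures for $\mathcal{P}$ of arbitrary cardinality which satisfies HP and JEP and is closed under unions of chains, then $\mathscr{K}=\mathrm{Age}(\mathbf{A},\mathbf{N})$ for some $\mathbf{A}$-structure $\langle\mathbf{A},\mathbf{N}\rangle$.
   Context: A UL-algebra is a structure $\mathbf{A}=\langle A,\wedge,\vee,\&,\to,\bar 0,\bar 1,\bot,\top\rangle$ such that $\langle A,\wedge,\vee,\bot,\top\rangle$ is a bounded lattice, $\langle A,\&,\bar 1\rangle$ is a commutative monoid, $a\& b\le c$ iff $b\le a\to c$ for all $a,b,c$, and $((a\to b)\wedge\bar 1)\vee((b\to a)\wedge \bar 1)=\bar 1$ for all $a,b$. A UL-chain is a UL-algebra whose lattice order is linear. A predicate language $\mathcal{P}$ consists of predicate symbols and function symbols, each with an arity. An $\mathbf{A}$-structure $\langle\mathbf{A},\mathbf{M}\rangle$ consists of a set $M$, a function $P_{\mathbf{M}}:M^n\to A$ for each $n$-ary predicate symbol $P$, and a function $F_{\mathbf{M}}:M^n\to M$ for each $n$-ary function symbol $F$. Terms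 are evaluated as usual; the truth value of an atomic formula $P(t_1,\dots,t_n)$ is $P_{\mathbf{M}}$ applied to the values of the terms, and quantifier-free formulas (built with the connectives $\wedge,\vee,\&,\to,\bar0,\bar1,\bot,\top$) are evaluated by the corresponding operations of $\mathbf{A}$; $\|\varphi(\vec d)\|^{\mathbf{A}}_{\mathbf{M}}$ denotes this value. $\langle\mathbf{A},\mathbf{M}\rangle$ is a substructure of $\langle\mathbf{A},\mathbf{N}\rangle$ if $M\subseteq N$, $F_{\mathbf{M}}=F_{\mathbf{N}}$ on tuples from $M$ for every function symbol, and every quantifier-free formula has the same value in both structures on every tuple from $M$. An embedding $\langle Id,f\rangle$ of $\langle\mathbf{A},\mathbf{M}\rangle$ into $\langle\mathbf{A},\mathbf{N}\rangle$ is an injective map $f:M\to N$ commuting with all function symbols and preserving the value of every quantifier-free formula (the map on $\mathbf{A}$ is the identity); an isomorphism is a surjective embedding. A structure is finitely generated if its universe is generated by a finite subset under the function symbols. A chain is a sequence of structures each a substructure of the later ones; its union has as universe the union of the universes with the relations and functions inherited. The age $\mathrm{Age}(\mathbf{A},\mathbf{N})$ is the class of all finitely generated substructures of $\langle\mathbf{A},\mathbf{N}\rangle$ and their isomorphic copies (taken up to isomorphism). $\mathscr{K}$ has HP if it is closed under taking substructures; it has JEP if any two members of $\mathscr{K}$ both embed into some common member of $\mathscr{K}$.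
   Formalization: K is assumed nonempty, HP is read as closure under finitely generated substructures, and in the "furthermore" part the members of K are also assumed finitely generated; without these the statement is false. -}

module Defs where

open import Level using (Level; _⊔_; suc)
open import Algebra.Core using (Op₂)
open import Algebra.Structures using (IsCommutativeMonoid)
open import Data.Fin.Base using (Fin)
open import Data.Maybe.Base using (Maybe)
open import Data.Maybe.Relation.Unary.All using (All)
open import Data.Maybe.Relation.Unary.Any using (Any)
open import Data.Nat.Base as ℕ using (ℕ)
open import Data.Product.Base using (Σ; ∃; ∃₂; _×_; _,_; proj₁; proj₂; map₂)
open import Data.Vec.Functional using (Vector)
open import Function.Base using (_∘_)
open import Function.Bundles using (_⇔_)
open import Function.Definitions using (Congruent; Injective; Surjective)
open import Relation.Binary.Bundles using (Setoid)
open import Relation.Binary.Core using (Rel)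
open import Relation.Binary.Definitions using (Total; _Respects_)
import Relation.Binary.Construct.On as On
open import Relation.Binary.Lattice.Structures using (IsBoundedLattice)
open import Relation.Unary using (Pred; _∈_; _⊆_)

-- Sets are setoids throughout, all living in one universe ℓ.

record IsULAlgebra {ℓ} {A : Set ℓ} (_≈_ _≤_ : Rel A ℓ)
                   (_∧_ _∨_ _&_ _⇒_ : Op₂ A) (0̄ 1̄ ⊥ ⊤ : A) : Set ℓ where
  field
    isBoundedLattice    : IsBoundedLattice _≈_ _≤_ _∨_ _∧_ ⊤ ⊥
    isCommutativeMonoid : IsCommutativeMonoid _≈_ _&_ 1̄
    residuation         : ∀ a b c → ((a & b) ≤ c) ⇔ (b ≤ (a ⇒ c))
    prelinearity        : ∀ a b → (((a ⇒ b) ∧ 1̄) ∨ ((b ⇒ a) ∧ 1̄)) ≈ 1̄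

record ULChain (ℓ : Level) : Set (suc ℓ) where
  field
    Carrier         : Set ℓ
    _≈_ _≤_         : Rel Carrier ℓ
    _∧_ _∨_ _&_ _⇒_ : Op₂ Carrier
    0̄ 1̄ ⊥ ⊤         : Carrier
    isULAlgebra     : IsULAlgebra _≈_ _≤_ _∧_ _∨_ _&_ _⇒_ 0̄ 1̄ ⊥ ⊤
    total           : Total _≤_

record Language (ℓ : Level) : Set (suc ℓ) where
  field
    PredSym : Set ℓ
    FunSym  : Set ℓ
    arityᴾ  : PredSym → ℕ
    arityᶠ  : FunSym → ℕ

module Structures {ℓ : Level} (𝐀 : ULChain ℓ) (𝓟 : Language ℓ) where

  private module A = ULChain 𝐀
  open Language 𝓟

  data Term (n : ℕ) : Set ℓ where
    var : Fin n → Term n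
    app : (F : FunSym) → Vector (Term n) (arityᶠ F) → Term n

  -- Quantifier-free formulas in n free variables.
  data Formula (n : ℕ) : Set ℓ where
    atom                    : (P : PredSym) → Vector (Term n) (arityᴾ P) → Formula n
    _∧ᶠ_ _∨ᶠ_ _&ᶠ_ _⇒ᶠ_     : Formula n → Formula n → Formula n
    0̄ᶠ 1̄ᶠ ⊥ᶠ ⊤ᶠ             : Formula n

  record Interpretation (X : Setoid ℓ ℓ) : Set ℓ where
    open Setoid X using (_≈_) renaming (Carrier to M)
    field
      ⟦_⟧ᴾ      : (P : PredSym) → Vector M (arityᴾ P) → A.Carrier
      ⟦_⟧ᶠ      : (F : FunSym) → Vector M (arityᶠ F) → M
      ⟦⟧ᴾ-cong  : ∀ P {u v} → (∀ i → u i ≈ v i) → ⟦ P ⟧ᴾ u A.≈ ⟦ P ⟧ᴾ v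
      ⟦⟧ᶠ-cong  : ∀ F {u v} → (∀ i → u i ≈ v i) → ⟦ F ⟧ᶠ u ≈ ⟦ F ⟧ᶠ v

  record Structure : Set (suc ℓ) where
    constructor structure
    field
      domain         : Setoid ℓ ℓ
      interpretation : Interpretation domain
    open Setoid domain public using (_≈_; Carrier)
    open Interpretation interpretation public

    value : ∀ {n} → Term n → Vector Carrier n → Carrier
    value (var i)    d = d i
    value (app F ts) d = ⟦ F ⟧ᶠ (λ i → value (ts i) d)

    ∥_∥ : ∀ {n} → Formula n → Vector Carrier n → A.Carrier
    ∥ atom P ts ∥ d = ⟦ P ⟧ᴾ (λ i → value (ts i) d)
    ∥ φ ∧ᶠ ψ ∥    d = ∥ φ ∥ d A.∧ ∥ ψ ∥ d
    ∥ φ ∨ᶠ ψ ∥    d = ∥ φ ∥ d A.∨ ∥ ψ ∥ d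
    ∥ φ &ᶠ ψ ∥    d = ∥ φ ∥ d A.& ∥ ψ ∥ d
    ∥ φ ⇒ᶠ ψ ∥    d = ∥ φ ∥ d A.⇒ ∥ ψ ∥ d
    ∥ 0̄ᶠ ∥        d = A.0̄
    ∥ 1̄ᶠ ∥        d = A.1̄
    ∥ ⊥ᶠ ∥        d = A.⊥
    ∥ ⊤ᶠ ∥        d = A.⊤

  private module S = Structure

  record Preserves (M N : Structure) (f : S.Carrier M → S.Carrier N) : Set ℓ where
    field
      functions : ∀ F (d : Vector (S.Carrier M) (arityᶠ F)) →
                  S._≈_ N (f (S.⟦_⟧ᶠ M F d)) (S.⟦_⟧ᶠ N F (f ∘ d))
      formulas  : ∀ {n} (φ : Formula n) (d : Vector (S.Carrier M) n) →
                  S.∥_∥ M φ d A.≈ S.∥_∥ N φ (f ∘ d)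

  record Embedding (M N : Structure) : Set ℓ where
    field
      map       : S.Carrier M → S.Carrier N
      cong      : Congruent (S._≈_ M) (S._≈_ N) map
      injective : Injective (S._≈_ M) (S._≈_ N) map
      preserves : Preserves M N map

  infix 4 _≅_
  record _≅_ (M N : Structure) : Set ℓ where
    field
      embedding  : Embedding M N
      surjective : Surjective (S._≈_ M) (S._≈_ N) (Embedding.map embedding)

  subsetoid : (X : Setoid ℓ ℓ) → Pred (Setoid.Carrier X) ℓ → Setoid ℓ ℓ
  subsetoid X U = On.setoid {B = Σ (Setoid.Carrier X) U} X proj₁

  record Substructure (N : Structure) : Set (suc ℓ) where
    field
      universe       : Pred (S.Carrier N) ℓ
      respects       : universe Respects S._≈_ N
      interpretation : Interpretation (subsetoid (S.domain N) universe)

    toStructure : Structure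
    toStructure = structure (subsetoid (S.domain N) universe) interpretation

    field
      agrees : Preserves toStructure N proj₁

  open Substructure using (universe; toStructure)

  infix 4 _⊑_
  record _⊑_ {N : Structure} (S T : Substructure N) : Set ℓ where
    field
      inclusion : universe S ⊆ universe T
      agrees    : Preserves (toStructure S) (toStructure T) (map₂ inclusion)

  data Generated (M : Structure) {k} (g : Vector (S.Carrier M) k) : Pred (S.Carrier M) ℓ where
    generator : ∀ i → Generated M g (g i)
    apply     : ∀ F v → (∀ i → Generated M g (v i)) → Generated M g (S.⟦_⟧ᶠ M F v)
    resp      : Generated M g Respects S._≈_ M

  FinitelyGenerated : Pred Structure ℓ
  FinitelyGenerated M =
    ∃₂ λ k (g : Vector (S.Carrier M) k) → ∀ x → x ∈ Generated M g

  Age : Structure → Pred Structure (suc ℓ)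
  Age N M = ∃ λ (T : Substructure N) →
    FinitelyGenerated (toStructure T) × M ≅ toStructure T

  -- A chain is presented inside its union N: a sequence of substructures of N,
  -- each a substructure of the later ones, whose universes exhaust that of N.
  record IsUnionOfChain (N : Structure) (C : ℕ → Substructure N) : Set ℓ where
    field
      chain  : ∀ {i j} → i ℕ.≤ j → C i ⊑ C j
      covers : ∀ x → ∃ λ i → x ∈ universe (C i)

  module _ {κ : Level} (K : Pred Structure κ) where

    -- At most countable up to isomorphism; `nothing` allows for finite
    -- (including empty) classes.
    Countable : Set (suc ℓ ⊔ κ)
    Countable = ∃ λ (e : ℕ → Maybe Structure) →
      (∀ n → All K (e n)) ×
      (∀ M → M ∈ K → ∃ λ n → Any (M ≅_) (e n))

    -- Restricted to finitely generated substructures: over a language with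
    -- function symbols a finitely generated structure may have substructures
    -- that are not finitely generated, and these never belong to an age.
    HP : Set (suc ℓ ⊔ κ)
    HP = ∀ M → M ∈ K → (T : Substructure M) →
      FinitelyGenerated (toStructure T) → toStructure T ∈ K

    JEP : Set (suc ℓ ⊔ κ)
    JEP = ∀ M₁ M₂ → M₁ ∈ K → M₂ ∈ K →
      ∃ λ L → L ∈ K × Embedding M₁ L × Embedding M₂ L

    ClosedUnderUnionsOfChains : Set (suc ℓ ⊔ κ)
    ClosedUnderUnionsOfChains = ∀ N (C : ℕ → Substructure N) →
      IsUnionOfChain N C → (∀ i → toStructure (C i) ∈ K) → N ∈ K

{-# OPTIONS --safe #-}

-- A structure lies in Age N exactly when it is finitely generated and embeds
-- in N.  Hence an age is inherited by finitely generated substructures, and two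
-- members embed jointly in the substructure of N generated by both sets of
-- generators.  Conversely, joint embedding turns an enumeration of K into an
-- ω-chain of members of K that absorbs one enumerated structure at each step;
-- a finitely generated structure embedding in the direct limit already embeds
-- in some stage, so K is the age of the limit.
--
-- Closure under unions of chains forces some member of K to embed all the
-- others, so that K is its age: if every L in K missed some M in K, then
-- joint embedding of L with such an M would give an ω-chain whose limit belongs
-- to K, hence is finitely generated and embeds in a stage, although it embeds
-- the structure missed by that stage.
module Submission where

open import Defs
open import Level using (Level; _⊔_; suc)
open import Axiom.ExcludedMiddle using (ExcludedMiddle)
open import Algebra.Structures using (IsCommutativeMonoid)
open import Axiom.DoubleNegationElimination using (DoubleNegationElimination; em⇒dne)
open import Data.Empty using (⊥-elim)
open import Data.Fin.Base as Fin using (zero; _↑ˡ_; _↑ʳ_)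
open import Data.Maybe.Base using (Maybe; just; nothing)
open import Data.Maybe.Relation.Unary.All using (All; just; nothing)
open import Data.Maybe.Relation.Unary.Any using (Any; just)
open import Data.Nat.Base as ℕ using (ℕ; _≤_; _≤′_; ≤′-reflexive; ≤′-refl; ≤′-step)
import Data.Nat.Properties as ℕ
open import Data.Product.Base using (Σ; ∃; _×_; _,_; proj₁; proj₂; map₂)
open import Data.Vec.Functional using (Vector; foldr; _++_)
open import Data.Vec.Functional.Properties using (lookup-++ˡ; lookup-++ʳ)
open import Function.Base using (_∘_; id)
open import Function.Bundles using (_⇔_; Equivalence; mk⇔)
open import Relation.Binary.Bundles using (Setoid)
open import Relation.Binary.Core using (_Preserves₂_⟶_⟶_)
open import Relation.Binary.Definitions using (_Respects_)
open import Relation.Binary.Lattice.Structures using (IsBoundedLattice)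
open import Relation.Binary.PropositionalEquality.Core as ≡ using (_≡_)
open import Relation.Nullary.Negation.Core using (¬_)
open import Relation.Unary using (Pred; _∈_; _⊆_; _≐_; Satisfiable)
import Relation.Binary.Lattice.Properties.JoinSemilattice as JoinProperties
import Relation.Binary.Lattice.Properties.MeetSemilattice as MeetProperties
import Relation.Binary.Reasoning.Setoid as SetoidReasoning

-- Uniqueness of order proofs and finite suprema in ℕ.

-- The transition maps of a direct limit are built by recursion on proofs of `≤′`; this makes them
-- depend on the two stages alone.
≤′-irrelevant : ∀ {m n} (p q : m ≤′ n) → p ≡ q
≤′-irrelevant (≤′-reflexive p) (≤′-reflexive q) = ≡.cong ≤′-reflexive (ℕ.≡-irrelevant p q)
≤′-irrelevant (≤′-step p)      (≤′-step q)      = ≡.cong ≤′-step (≤′-irrelevant p q)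
≤′-irrelevant ≤′-refl          (≤′-step q)      = ⊥-elim (ℕ.1+n≰n (ℕ.≤′⇒≤ q))
≤′-irrelevant (≤′-step p)      ≤′-refl          = ⊥-elim (ℕ.1+n≰n (ℕ.≤′⇒≤ p))

⋁ : ∀ {k} → Vector ℕ k → ℕ
⋁ = foldr ℕ._⊔_ 0

≤⋁ : ∀ {k} (v : Vector ℕ k) i → v i ≤ ⋁ v
≤⋁ v zero        = ℕ.m≤m⊔n _ _
≤⋁ v (Fin.suc i) = ℕ.≤-trans (≤⋁ (v ∘ Fin.suc) i) (ℕ.m≤n⊔m _ _)

-- The operations of a UL-chain respect equality.

module ULChainProperties {ℓ} (𝐀 : ULChain ℓ) where
  open ULChain 𝐀 renaming (_≤_ to _≤ᴬ_)
  open IsULAlgebra isULAlgebra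
  open IsBoundedLattice isBoundedLattice using
    (isJoinSemilattice; isMeetSemilattice; antisym; reflexive; module Eq)
    renaming (trans to ≤-trans; refl to ≤-refl)
  open IsCommutativeMonoid isCommutativeMonoid public using (setoid) renaming (∙-cong to &-cong)

  ∨-cong : _∨_ Preserves₂ _≈_ ⟶ _≈_ ⟶ _≈_
  ∨-cong = JoinProperties.∨-cong (record { isJoinSemilattice = isJoinSemilattice })

  ∧-cong : _∧_ Preserves₂ _≈_ ⟶ _≈_ ⟶ _≈_
  ∧-cong = MeetProperties.∧-cong (record { isMeetSemilattice = isMeetSemilattice })

  -- By residuation `a ⇒ b` is the largest `c` with `a & c ≤ b`, a condition invariant under
  -- equality of `a` and `b`; antisymmetry turns the two inequalities into an equality.
  ⇒-cong : _⇒_ Preserves₂ _≈_ ⟶ _≈_ ⟶ _≈_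
  ⇒-cong a≈a′ b≈b′ = antisym (mono a≈a′ b≈b′) (mono (Eq.sym a≈a′) (Eq.sym b≈b′))
    where
    mono : ∀ {a a′ b b′} → a ≈ a′ → b ≈ b′ → (a ⇒ b) ≤ᴬ (a′ ⇒ b′)
    mono {a} {a′} {b} {b′} a≈a′ b≈b′ = Equivalence.to (residuation a′ (a ⇒ b) b′)
      (≤-trans (reflexive (&-cong (Eq.sym a≈a′) Eq.refl))
      (≤-trans (Equivalence.from (residuation a (a ⇒ b) b) ≤-refl)
               (reflexive b≈b′)))

module AgeProperties {ℓ : Level} (𝐀 : ULChain ℓ) (𝓟 : Language ℓ) where
  open Structures 𝐀 𝓟
  open Language 𝓟
  private
    module S = Structure
    module A where
      open ULChain 𝐀 public using (_≈_)
      open ULChainProperties 𝐀 public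
      open Setoid setoid public using (refl; sym; trans)
  open Substructure using (universe; toStructure)

  -- Embeddings, images and substructures.

  -- Induction on terms and formulas, the connectives being congruences. Every embedding constructed
  -- below is checked on symbols only.
  atoms⇒preserves : ∀ {M N} (f : S.Carrier M → S.Carrier N) →
    (∀ F d → S._≈_ N (f (S.⟦_⟧ᶠ M F d)) (S.⟦_⟧ᶠ N F (f ∘ d))) →
    (∀ P d → S.⟦_⟧ᴾ M P d A.≈ S.⟦_⟧ᴾ N P (f ∘ d)) →
    Preserves M N f
  atoms⇒preserves {M} {N} f f-fun f-pred = record { functions = f-fun ; formulas = formulas }
    where
    module N = Setoid (S.domain N)

    values : ∀ {n} (t : Term n) d → f (S.value M t d) N.≈ S.value N t (f ∘ d)
    values (var i)    d = N.refl
    values (app F ts) d = N.trans (f-fun F _) (S.⟦⟧ᶠ-cong N F λ i → values (ts i) d)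

    formulas : ∀ {n} (φ : Formula n) d → S.∥_∥ M φ d A.≈ S.∥_∥ N φ (f ∘ d)
    formulas (atom P ts) d = A.trans (f-pred P _) (S.⟦⟧ᴾ-cong N P λ i → values (ts i) d)
    formulas (φ ∧ᶠ ψ)    d = A.∧-cong (formulas φ d) (formulas ψ d)
    formulas (φ ∨ᶠ ψ)    d = A.∨-cong (formulas φ d) (formulas ψ d)
    formulas (φ &ᶠ ψ)    d = A.&-cong (formulas φ d) (formulas ψ d)
    formulas (φ ⇒ᶠ ψ)    d = A.⇒-cong (formulas φ d) (formulas ψ d)
    formulas 0̄ᶠ          d = A.refl
    formulas 1̄ᶠ          d = A.refl
    formulas ⊥ᶠ          d = A.refl
    formulas ⊤ᶠ          d = A.refl

  -- The formula `atom P var` evaluates by definition to the predicate itself.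
  predicates : ∀ {M N f} → Preserves M N f → ∀ P (d : Vector (S.Carrier M) (arityᴾ P)) →
    S.⟦_⟧ᴾ M P d A.≈ S.⟦_⟧ᴾ N P (f ∘ d)
  predicates pres P d = Preserves.formulas pres (atom P var) d

  module _ {M N : Structure} (f : Embedding M N) where
    open Embedding f public using () renaming (map to _⟨$⟩_)

  module E {M N : Structure} (f : Embedding M N) where
    open Embedding f public using (cong; injective; preserves)
    open Preserves preserves public using (functions)
    preds = predicates preserves

  idᴱ : ∀ {M} → Embedding M M
  idᴱ {M} = record
    { map = id ; cong = id ; injective = id
    ; preserves = atoms⇒preserves id (λ _ _ → M.refl) (λ _ _ → A.refl) }
    where module M = Setoid (S.domain M)

  infixr 9 _∘ᴱ_
  _∘ᴱ_ : ∀ {L M N} → Embedding M N → Embedding L M → Embedding L N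
  _∘ᴱ_ {L} {M} {N} g f = record
    { map       = λ x → g ⟨$⟩ (f ⟨$⟩ x)
    ; cong      = E.cong g ∘ E.cong f
    ; injective = E.injective f ∘ E.injective g
    ; preserves = atoms⇒preserves _
        (λ F d → N.trans (E.cong g (E.functions f F d)) (E.functions g F _))
        (λ P d → A.trans (E.preds f P d) (E.preds g P _)) }
    where module N = Setoid (S.domain N)

  Image : ∀ {M N} → Embedding M N → Pred (S.Carrier N) ℓ
  Image {N = N} f y = ∃ λ x → S._≈_ N (f ⟨$⟩ x) y

  -- Injectivity of `g` makes preimages unique up to equality, so the chosen ones form the map "`f`
  -- followed by the inverse of `g`". Each of its properties is verified after applying `g`.
  factor : ∀ {L M N} (f : Embedding M N) (g : Embedding L N) →
    (∀ x → f ⟨$⟩ x ∈ Image g) → Embedding M L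
  factor {L} {M} {N} f g f⊆g = record
    { map       = h
    ; cong      = λ {x} {y} x≈y → E.injective g
        (N.trans (gh≈f x) (N.trans (E.cong f x≈y) (N.sym (gh≈f y))))
    ; injective = λ {x} {y} hx≈hy → E.injective f
        (N.trans (N.sym (gh≈f x)) (N.trans (E.cong g hx≈hy) (gh≈f y)))
    ; preserves = atoms⇒preserves h
        (λ F d → E.injective g (begin
          g ⟨$⟩ h (S.⟦_⟧ᶠ M F d)            ≈⟨ gh≈f _ ⟩
          f ⟨$⟩ S.⟦_⟧ᶠ M F d                ≈⟨ E.functions f F d ⟩
          S.⟦_⟧ᶠ N F (λ i → f ⟨$⟩ d i)      ≈⟨ S.⟦⟧ᶠ-cong N F (λ i → gh≈f (d i)) ⟨
          S.⟦_⟧ᶠ N F (λ i → g ⟨$⟩ h (d i))  ≈⟨ E.functions g F _ ⟨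
          g ⟨$⟩ S.⟦_⟧ᶠ L F (h ∘ d)          ∎))
        (λ P d → A.trans (E.preds f P d)
          (A.trans (S.⟦⟧ᴾ-cong N P (λ i → N.sym (gh≈f (d i))))
                   (A.sym (E.preds g P _)))) }
    where
    module N = Setoid (S.domain N)
    open SetoidReasoning (S.domain N)
    h : S.Carrier M → S.Carrier L
    h x = proj₁ (f⊆g x)
    gh≈f : ∀ x → (g ⟨$⟩ h x) N.≈ (f ⟨$⟩ x)
    gh≈f x = proj₂ (f⊆g x)

  ≅-sym : ∀ {M N} → M ≅ N → N ≅ M
  ≅-sym {M} {N} M≅N = record
    -- The inverse is the identity of `N` factored through the surjective embedding.
    { embedding  = factor idᴱ embedding onto
    ; surjective = λ x → embedding ⟨$⟩ x , λ y≈fx →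
        E.injective embedding (N.trans (proj₂ (onto _)) y≈fx) }
    where
    open _≅_ M≅N
    module M = Setoid (S.domain M)
    module N = Setoid (S.domain N)
    onto : ∀ y → y ∈ Image embedding
    onto y = map₂ (λ eq → eq M.refl) (surjective y)

  Closed : ∀ N → Pred (S.Carrier N) ℓ → Set ℓ
  Closed N U = ∀ F v → (∀ i → v i ∈ U) → S.⟦_⟧ᶠ N F v ∈ U

  restrict : ∀ N (U : Pred (S.Carrier N) ℓ) → U Respects S._≈_ N → Closed N U → Substructure N
  restrict N U respects closed = record
    { universe       = U
    ; respects       = respects
    ; interpretation = record
        { ⟦_⟧ᴾ     = λ P v → S.⟦_⟧ᴾ N P (proj₁ ∘ v)
        ; ⟦_⟧ᶠ     = λ F v → S.⟦_⟧ᶠ N F (proj₁ ∘ v) , closed F _ (proj₂ ∘ v)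
        ; ⟦⟧ᴾ-cong = λ P → S.⟦⟧ᴾ-cong N P
        ; ⟦⟧ᶠ-cong = λ F → S.⟦⟧ᶠ-cong N F }
    ; agrees         = atoms⇒preserves proj₁ (λ _ _ → N.refl) (λ _ _ → A.refl) }
    where module N = Setoid (S.domain N)

  inclusion : ∀ {N} (T : Substructure N) → Embedding (toStructure T) N
  inclusion T = record
    { map = proj₁ ; cong = id ; injective = id ; preserves = Substructure.agrees T }

  -- Both interpretations agree with that of `N`, hence with each other.
  ⊆⇒⊑ : ∀ {N} (T U : Substructure N) → universe T ⊆ universe U → T ⊑ U
  ⊆⇒⊑ {N} T U T⊆U = record
    { inclusion = T⊆U
    ; agrees    = atoms⇒preserves _
        (λ F d → N.trans (E.functions (inclusion T) F d) (N.sym (E.functions (inclusion U) F _)))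
        (λ P d → A.trans (E.preds (inclusion T) P d) (A.sym (E.preds (inclusion U) P _))) }
    where module N = Setoid (S.domain N)

  Image-respects : ∀ {M N} (f : Embedding M N) → Image f Respects S._≈_ N
  Image-respects {N = N} f y≈z = map₂ (λ fx≈y → Setoid.trans (S.domain N) fx≈y y≈z)

  Image-closed : ∀ {M N} (f : Embedding M N) → Closed N (Image f)
  Image-closed {M} {N} f F v v∈f =
    S.⟦_⟧ᶠ M F (proj₁ ∘ v∈f) ,
    Setoid.trans (S.domain N) (E.functions f F _) (S.⟦⟧ᶠ-cong N F (proj₂ ∘ v∈f))

  image : ∀ {M N} → Embedding M N → Substructure N
  image {N = N} f = restrict N (Image f) (Image-respects f) (Image-closed f)

  ≅-image : ∀ {M N} (f : Embedding M N) → M ≅ toStructure (image f)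
  ≅-image {M} {N} f = record
    { embedding  = factor f (inclusion (image f)) (λ x → (f ⟨$⟩ x , x , N.refl) , N.refl)
    ; surjective = λ (y , x , fx≈y) → x , λ z≈x → N.trans (E.cong f z≈x) fx≈y }
    where module N = Setoid (S.domain N)

  -- Finite generation and ages.

  -- The preimage of a closed set under an embedding is closed, so it contains whatever its elements
  -- generate.
  generated-into : ∀ {M N} (f : Embedding M N) {k} {g : Vector (S.Carrier M) k} {U} →
    U Respects S._≈_ N → Closed N U → (∀ i → f ⟨$⟩ g i ∈ U) →
    ∀ {x} → x ∈ Generated M g → f ⟨$⟩ x ∈ U
  generated-into {M} {N} f {g = g} {U} respects closed g∈U = go
    where
    go : ∀ {x} → x ∈ Generated M g → f ⟨$⟩ x ∈ U
    go (generator i)  = g∈U i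
    go (apply F v v∈) = respects (Setoid.sym (S.domain N) (E.functions f F v))
                                 (closed F _ (λ i → go (v∈ i)))
    go (resp x≈y x∈)  = respects (E.cong f x≈y) (go x∈)

  FinitelyGenerated-respects-≅ : FinitelyGenerated Respects _≅_
  FinitelyGenerated-respects-≅ {M} {N} M≅N (k , g , gen) =
    k , (λ i → embedding ⟨$⟩ g i) , λ y →
      resp (proj₂ (surjective y) (Setoid.refl (S.domain M)))
           (generated-into embedding resp apply generator (gen _))
    where open _≅_ M≅N

  age⁺ : ∀ {M N} → FinitelyGenerated M → Embedding M N → M ∈ Age N
  age⁺ fg f = image f , FinitelyGenerated-respects-≅ (≅-image f) fg , ≅-image f

  age⇒fg : ∀ {M N} → M ∈ Age N → FinitelyGenerated M
  age⇒fg (T , fg , M≅T) = FinitelyGenerated-respects-≅ (≅-sym M≅T) fg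

  age⇒embedding : ∀ {M N} → M ∈ Age N → Embedding M N
  age⇒embedding (T , _ , M≅T) = inclusion T ∘ᴱ _≅_.embedding M≅T

  span : ∀ N {k} → Vector (S.Carrier N) k → Substructure N
  span N g = restrict N (Generated N g) resp apply

  span-fg : ∀ N {k} (g : Vector (S.Carrier N) k) → FinitelyGenerated (toStructure (span N g))
  span-fg N {k} g = k , g′ , λ (_ , y∈) → go y∈ y∈
    where
    module N = Setoid (S.domain N)
    g′ : Vector (S.Carrier (toStructure (span N g))) k
    g′ i = g i , generator i
    -- The first derivation drives the recursion, the second is the membership witness inside the
    -- point. Points are compared by their first components, so `resp N.refl` exchanges one witness
    -- for another.
    go : ∀ {y} → Generated N g y → (y∈ : y ∈ Generated N g) →
      Generated (toStructure (span N g)) g′ (y , y∈)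
    go (generator i)  _ = resp N.refl (generator i)
    go (apply F v v∈) _ = resp N.refl (apply F (λ i → v i , v∈ i) (λ i → go (v∈ i) (v∈ i)))
    go (resp x≈y x∈)  _ = resp x≈y (go x∈ x∈)

  age-JEP : ∀ N → JEP (Age N)
  age-JEP N M₁ M₂ M₁∈ M₂∈ with age⇒fg M₁∈ | age⇒fg M₂∈
  ... | k₁ , g₁ , gen₁ | k₂ , g₂ , gen₂ =
    toStructure T , age⁺ (span-fg N g) (inclusion T) ,
    factor f₁ (inclusion T) (λ x → (_ , generated-into f₁ resp apply g₁∈ (gen₁ x)) , N.refl) ,
    factor f₂ (inclusion T) (λ x → (_ , generated-into f₂ resp apply g₂∈ (gen₂ x)) , N.refl)
    where
    module N = Setoid (S.domain N)
    f₁ = age⇒embedding M₁∈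
    f₂ = age⇒embedding M₂∈
    h₁ = λ i → f₁ ⟨$⟩ g₁ i
    h₂ = λ i → f₂ ⟨$⟩ g₂ i
    g  = h₁ ++ h₂
    T  = span N g
    g₁∈ : ∀ i → Generated N g (h₁ i)
    g₁∈ i = resp (N.reflexive (lookup-++ˡ h₁ h₂ i)) (generator (i ↑ˡ k₂))
    g₂∈ : ∀ i → Generated N g (h₂ i)
    g₂∈ i = resp (N.reflexive (lookup-++ʳ h₁ h₂ i)) (generator (k₁ ↑ʳ i))

  age-HP : ∀ N → HP (Age N)
  age-HP N M M∈ T fg = age⁺ fg (age⇒embedding M∈ ∘ᴱ inclusion T)

  -- The direct limit of an ω-chain of embeddings.

  module DirectLimit (L : ℕ → Structure) (step : ∀ n → Embedding (L n) (L (ℕ.suc n))) where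

    private module L (n : ℕ) where
      open Setoid (S.domain (L n)) public

    -- `≤′` grows at its upper end, so each `≤′-step` composes with one further transition map.
    lift′ : ∀ {m n} → m ≤′ n → Embedding (L m) (L n)
    lift′ ≤′-refl     = idᴱ
    lift′ (≤′-step p) = step _ ∘ᴱ lift′ p

    lift′-∘ : ∀ {k m n} (p : k ≤′ m) (q : m ≤′ n) (r : k ≤′ n) x →
      L._≈_ n (lift′ q ⟨$⟩ (lift′ p ⟨$⟩ x)) (lift′ r ⟨$⟩ x)
    lift′-∘ {n = n} p ≤′-refl     r x = L.reflexive n (≡.cong (λ s → lift′ s ⟨$⟩ x) (≤′-irrelevant p r))
    lift′-∘ {n = n} p (≤′-step q) r x = L.trans n
      (E.cong (step _) (lift′-∘ p q (ℕ.≤′-trans p q) x))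
      (L.reflexive n (≡.cong (λ s → lift′ s ⟨$⟩ x) (≤′-irrelevant (≤′-step (ℕ.≤′-trans p q)) r)))

    lift : ∀ {m n} → m ≤ n → Embedding (L m) (L n)
    lift p = lift′ (ℕ.≤⇒≤′ p)

    lift-∘ : ∀ {k m n} (p : k ≤ m) (q : m ≤ n) (r : k ≤ n) x →
      L._≈_ n (lift q ⟨$⟩ (lift p ⟨$⟩ x)) (lift r ⟨$⟩ x)
    lift-∘ p q r = lift′-∘ (ℕ.≤⇒≤′ p) (ℕ.≤⇒≤′ q) (ℕ.≤⇒≤′ r)

    Point : Set ℓ
    Point = Σ ℕ λ n → S.Carrier (L n)

    at : ∀ {n} (x : Point) → proj₁ x ≤ n → S.Carrier (L n)
    at (_ , x) p = lift p ⟨$⟩ x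

    infix 4 _~_
    -- The limit is the disjoint union of the stages with a coarser equality: two points are
    -- identified when they agree at the later of their stages.
    _~_ : Point → Point → Set ℓ
    x ~ y = L._≈_ (proj₁ x ℕ.⊔ proj₁ y) (at x (ℕ.m≤m⊔n _ _)) (at y (ℕ.m≤n⊔m (proj₁ x) _))

    -- Injectivity of the transition maps makes equality at one stage equality at every stage.
    ≈-shift : ∀ (x y : Point) {m n} p q p′ q′ →
      L._≈_ m (at x p) (at y q) → L._≈_ n (at x p′) (at y q′)
    ≈-shift x y {m} {n} p q p′ q′ eq = E.injective (lift n≤) (begin
      lift n≤ ⟨$⟩ at x p′  ≈⟨ lift-∘ p′ n≤ x≤ _ ⟩
      at x x≤              ≈⟨ lift-∘ p m≤ x≤ _ ⟨
      lift m≤ ⟨$⟩ at x p   ≈⟨ E.cong (lift m≤) eq ⟩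
      lift m≤ ⟨$⟩ at y q   ≈⟨ lift-∘ q m≤ y≤ _ ⟩
      at y y≤              ≈⟨ lift-∘ q′ n≤ y≤ _ ⟨
      lift n≤ ⟨$⟩ at y q′  ∎)
      where
      m≤ = ℕ.m≤m⊔n m n
      n≤ = ℕ.m≤n⊔m m n
      x≤ = ℕ.≤-trans p m≤
      y≤ = ℕ.≤-trans q m≤
      open SetoidReasoning (S.domain (L (m ℕ.⊔ n)))

    ~⁺ : ∀ {n} (x y : Point) p q → L._≈_ n (at x p) (at y q) → x ~ y
    ~⁺ x y p q = ≈-shift x y p q (ℕ.m≤m⊔n _ _) (ℕ.m≤n⊔m (proj₁ x) _)

    ~⁻ : ∀ {n} (x y : Point) p q → x ~ y → L._≈_ n (at x p) (at y q)
    ~⁻ x y p q = ≈-shift x y (ℕ.m≤m⊔n _ _) (ℕ.m≤n⊔m (proj₁ x) _) p q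

    ~-trans : ∀ x y z → x ~ y → y ~ z → x ~ z
    ~-trans x y z x~y y~z = ~⁺ x z x≤ z≤
      (L.trans _ (~⁻ x y x≤ y≤ x~y) (~⁻ y z y≤ z≤ y~z))
      where
      n = proj₁ x ℕ.⊔ proj₁ y ℕ.⊔ proj₁ z
      z≤ = ℕ.m≤n⊔m (proj₁ x ℕ.⊔ proj₁ y) (proj₁ z)
      x≤ = ℕ.≤-trans (ℕ.m≤m⊔n (proj₁ x) (proj₁ y)) (ℕ.m≤m⊔n _ (proj₁ z))
      y≤ = ℕ.≤-trans (ℕ.m≤n⊔m (proj₁ x) (proj₁ y)) (ℕ.m≤m⊔n _ (proj₁ z))

    domain : Setoid ℓ ℓ
    domain = record
      { Carrier = Point
      ; _≈_ = _~_
      ; isEquivalence = record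
          { refl  = λ {x} → ~⁺ x x ℕ.≤-refl ℕ.≤-refl (L.refl _)
          ; sym   = λ {x} {y} x~y → ~⁺ y x (ℕ.m≤n⊔m (proj₁ x) _) (ℕ.m≤m⊔n _ _) (L.sym _ x~y)
          ; trans = λ {x} {y} {z} → ~-trans x y z } }

    ⌈_⌉ : ∀ {k} → Vector Point k → ℕ
    ⌈ u ⌉ = ⋁ (proj₁ ∘ u)

    atᵛ : ∀ {k n} (u : Vector Point k) → ⌈ u ⌉ ≤ n → Vector (S.Carrier (L n)) k
    atᵛ u p i = at (u i) (ℕ.≤-trans (≤⋁ (proj₁ ∘ u) i) p)

    atᵛ-cong : ∀ {k n} {u v : Vector Point k} (p : ⌈ u ⌉ ≤ n) (q : ⌈ v ⌉ ≤ n) →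
      (∀ i → u i ~ v i) → ∀ i → L._≈_ n (atᵛ u p i) (atᵛ v q i)
    atᵛ-cong {u = u} {v} p q u~v i = ~⁻ (u i) (v i)
      (ℕ.≤-trans (≤⋁ (proj₁ ∘ u) i) p) (ℕ.≤-trans (≤⋁ (proj₁ ∘ v) i) q) (u~v i)

    atᵛ-lift : ∀ {k m n} (u : Vector Point k) (p : ⌈ u ⌉ ≤ m) (q : m ≤ n) (r : ⌈ u ⌉ ≤ n) →
      ∀ i → L._≈_ n (lift q ⟨$⟩ atᵛ u p i) (atᵛ u r i)
    atᵛ-lift u p q r i = lift-∘ (ℕ.≤-trans (≤⋁ (proj₁ ∘ u) i) p) q
      (ℕ.≤-trans (≤⋁ (proj₁ ∘ u) i) r) (proj₂ (u i))

    -- Symbols are interpreted at the least stage that bounds all arguments; for nullary symbols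
    -- this is stage 0.
    evalᴾ : ∀ P → Vector Point (arityᴾ P) → ULChain.Carrier 𝐀
    evalᴾ P u = S.⟦_⟧ᴾ (L ⌈ u ⌉) P (atᵛ u ℕ.≤-refl)

    evalᶠ : ∀ F → Vector Point (arityᶠ F) → Point
    evalᶠ F u = ⌈ u ⌉ , S.⟦_⟧ᶠ (L ⌈ u ⌉) F (atᵛ u ℕ.≤-refl)

    -- Transition maps are embeddings, so any later stage gives the same value. Argument vectors
    -- with different bounds can thus be compared at a common stage.
    evalᴾ-at : ∀ {n} P u (p : ⌈ u ⌉ ≤ n) → evalᴾ P u A.≈ S.⟦_⟧ᴾ (L n) P (atᵛ u p)
    evalᴾ-at {n} P u p = A.trans (E.preds (lift p) P _)
      (S.⟦⟧ᴾ-cong (L n) P (atᵛ-lift u ℕ.≤-refl p p))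

    evalᶠ-at : ∀ {n} F u (p : ⌈ u ⌉ ≤ n) → L._≈_ n (at (evalᶠ F u) p) (S.⟦_⟧ᶠ (L n) F (atᵛ u p))
    evalᶠ-at {n} F u p = L.trans n (E.functions (lift p) F _)
      (S.⟦⟧ᶠ-cong (L n) F (atᵛ-lift u ℕ.≤-refl p p))

    limit : Structure
    limit = structure domain record
      { ⟦_⟧ᴾ     = evalᴾ
      ; ⟦_⟧ᶠ     = evalᶠ
      ; ⟦⟧ᴾ-cong = λ P {u} {v} u~v →
          A.trans (evalᴾ-at P u (u≤ u v))
          (A.trans (S.⟦⟧ᴾ-cong (L _) P (atᵛ-cong (u≤ u v) (v≤ u v) u~v))
                   (A.sym (evalᴾ-at P v (v≤ u v))))
      ; ⟦⟧ᶠ-cong = λ F {u} {v} u~v → ~⁺ (evalᶠ F u) (evalᶠ F v) (u≤ u v) (v≤ u v)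
          (L.trans _ (evalᶠ-at F u (u≤ u v))
          (L.trans _ (S.⟦⟧ᶠ-cong (L _) F (atᵛ-cong (u≤ u v) (v≤ u v) u~v))
                     (L.sym _ (evalᶠ-at F v (v≤ u v))))) }
      where
      u≤ : ∀ {k} (u v : Vector Point k) → ⌈ u ⌉ ≤ ⌈ u ⌉ ℕ.⊔ ⌈ v ⌉
      u≤ u v = ℕ.m≤m⊔n _ _
      v≤ : ∀ {k} (u v : Vector Point k) → ⌈ v ⌉ ≤ ⌈ u ⌉ ℕ.⊔ ⌈ v ⌉
      v≤ u v = ℕ.m≤n⊔m ⌈ u ⌉ _

    ι : ∀ n → Embedding (L n) limit
    ι n = record
      { map       = n ,_
      ; cong      = λ {x} {y} x≈y → ~⁺ (n , x) (n , y) ℕ.≤-refl ℕ.≤-refl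
          (E.cong (lift ℕ.≤-refl) x≈y)
      ; injective = λ {x} {y} x~y → E.injective (lift (ℕ.≤-refl {n}))
          (~⁻ (n , x) (n , y) ℕ.≤-refl ℕ.≤-refl x~y)
      ; preserves = atoms⇒preserves (n ,_)
          (λ F d → ~⁺ (n , S.⟦_⟧ᶠ (L n) F d) (evalᶠ F (λ i → n , d i)) (n≤ d) (d≤ d)
             (L.trans _ (E.functions (lift (n≤ d)) F d)
             (L.trans _ (S.⟦⟧ᶠ-cong (L _) F (lift-const d))
                        (L.sym _ (evalᶠ-at F (λ i → n , d i) (d≤ d))))))
          (λ P d →
             A.trans (E.preds (lift (n≤ d)) P d)
             (A.trans (S.⟦⟧ᴾ-cong (L _) P (lift-const d))
                      (A.sym (evalᴾ-at P (λ i → n , d i) (d≤ d))))) }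
      where
      -- The bound of a vector constantly n is 0, not n, when the vector is empty.
      module _ {k} (d : Vector (S.Carrier (L n)) k) where
        b = ⌈ (λ i → n , d i) ⌉
        n≤ : n ≤ n ℕ.⊔ b
        n≤ = ℕ.m≤m⊔n n b
        d≤ : b ≤ n ℕ.⊔ b
        d≤ = ℕ.m≤n⊔m n b
        lift-const : ∀ i → L._≈_ (n ℕ.⊔ b) (lift n≤ ⟨$⟩ d i) (atᵛ (λ i → n , d i) d≤ i)
        -- Both sides transport the same point along different proofs of the bound; reflexivity of
        -- `~` identifies them.
        lift-const i = ~⁻ (n , d i) (n , d i) n≤ (ℕ.≤-trans (≤⋁ {k} (λ _ → n) i) d≤)
          (Setoid.refl domain {n , d i})

    ∈-Image-ι : ∀ {n} (x : Point) → proj₁ x ≤ n → x ∈ Image (ι n)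
    ∈-Image-ι x p = at x p , ~⁺ (_ , at x p) x ℕ.≤-refl p (lift-∘ p ℕ.≤-refl p _)

    -- The finitely many generators have images in stage `n`, the maximum of their levels. The image
    -- of `ι n` is closed, so it contains all of `M`, and `f` factors through `ι n`.
    limit-compact : ∀ {M} → FinitelyGenerated M → Embedding M limit → ∃ λ n → Embedding M (L n)
    limit-compact (_ , g , gen) f = n , factor f (ι n) λ x →
      generated-into f {U = Image (ι n)} (λ {x} {y} → Image-respects (ι n) {x} {y})
        (Image-closed (ι n)) (λ i → ∈-Image-ι (f ⟨$⟩ g i) (≤⋁ levels i)) (gen x)
      where
      levels = λ i → proj₁ (f ⟨$⟩ g i)
      n      = ⋁ levels

    -- A chain has to consist of substructures of its union, so each stage is represented by its
    -- isomorphic image in the limit.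
    limit-isUnionOfChain : IsUnionOfChain limit (λ n → image (ι n))
    limit-isUnionOfChain = record
      { chain  = λ {m} {n} m≤n → ⊆⇒⊑ (image (ι m)) (image (ι n)) λ {y} (x , x~y) →
          Image-respects (ι n) {m , x} {y} x~y (∈-Image-ι (m , x) m≤n)
      ; covers = λ x → proj₁ x , ∈-Image-ι x ℕ.≤-refl }

  -- Classes of structures as ages.

  module _ {κ} (K : Pred Structure κ) where

    fg-embedding⇒∈ : K Respects _≅_ → HP K → ∀ {M N} →
      FinitelyGenerated M → Embedding M N → N ∈ K → M ∈ K
    fg-embedding⇒∈ respects hp {N = N} fg f N∈K =
      let T , T-fg , M≅T = age⁺ fg f in respects (≅-sym M≅T) (hp N N∈K T T-fg)

    universal⇒age : K Respects _≅_ → K ⊆ FinitelyGenerated → HP K →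
      ∀ {N} → N ∈ K → (∀ M → M ∈ K → Embedding M N) → K ≐ Age N
    universal⇒age respects K⊆FG hp N∈K universal =
      (λ M∈K → age⁺ (K⊆FG M∈K) (universal _ M∈K)) ,
      (λ M∈Age → fg-embedding⇒∈ respects hp (age⇒fg M∈Age) (age⇒embedding M∈Age) N∈K)

    -- `Q n` records what the passage from stage `n` to the next achieves: absorbing the enumerated
    -- structure, or embedding one that was missed.
    module Iterate {q} (Q : ℕ → Structure → Structure → Set q) (start : Satisfiable K)
      (extend : ∀ n L → L ∈ K → ∃ λ L′ → L′ ∈ K × Embedding L L′ × Q n L L′) where

      stage : ℕ → ∃ K
      stage ℕ.zero    = start
      stage (ℕ.suc n) =
        let L′ , L′∈K , _ = extend n (proj₁ (stage n)) (proj₂ (stage n)) in L′ , L′∈K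

      extension : ∀ n → Embedding (proj₁ (stage n)) (proj₁ (stage (ℕ.suc n)))
                      × Q n (proj₁ (stage n)) (proj₁ (stage (ℕ.suc n)))
      extension n = proj₂ (proj₂ (extend n (proj₁ (stage n)) (proj₂ (stage n))))

      open DirectLimit (proj₁ ∘ stage) (proj₁ ∘ extension) public

    absorb : JEP K → (m : Maybe Structure) → All K m → ∀ L → L ∈ K →
      ∃ λ L′ → L′ ∈ K × Embedding L L′ × All (λ M → Embedding M L′) m
    -- An empty slot of the enumeration repeats the current stage.
    absorb jep nothing  _          L L∈K = L , L∈K , idᴱ , nothing
    absorb jep (just M) (just M∈K) L L∈K =
      let L′ , L′∈K , f , g = jep L M L∈K M∈K in L′ , L′∈K , f , just g

    All-Any-embedding : ∀ {M N} {m : Maybe Structure} →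
      All (λ S → Embedding S N) m → Any (M ≅_) m → Embedding M N
    All-Any-embedding (just f) (just M≅S) = f ∘ᴱ _≅_.embedding M≅S

    countable⇒age : K Respects _≅_ → Satisfiable K → K ⊆ FinitelyGenerated → Countable K →
      HP K → JEP K → ∃ λ N → K ≐ Age N
    countable⇒age respects start K⊆FG (e , e∈K , enumerates) hp jep =
      limit ,
      (λ M∈K → let n , M≅eₙ = enumerates _ M∈K in
        -- The structure enumerated at index `n` is absorbed in stage `n + 1`.
        age⁺ (K⊆FG M∈K) (ι (ℕ.suc n) ∘ᴱ All-Any-embedding (proj₂ (extension n)) M≅eₙ)) ,
      (λ M∈Age →
        let fg    = age⇒fg M∈Age
            n , f = limit-compact fg (age⇒embedding M∈Age)
        in fg-embedding⇒∈ respects hp fg f (proj₂ (stage n)))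
      where
      EmbedsNext : ℕ → Structure → Structure → Set (suc ℓ)
      EmbedsNext n _ L′ = All (λ M → Embedding M L′) (e n)

      extend : ∀ n L → L ∈ K → ∃ λ L′ → L′ ∈ K × Embedding L L′ × EmbedsNext n L L′
      extend n = absorb jep (e n) (e∈K n)

      open Iterate EmbedsNext start extend

    age⇒HP×JEP : (∃ λ N → K ≐ Age N) → HP K × JEP K
    age⇒HP×JEP (N , K⊆Age , Age⊆K) =
      (λ M M∈K T fg → Age⊆K (age-HP N M (K⊆Age M∈K) T fg)) ,
      (λ M₁ M₂ M₁∈K M₂∈K →
        let L , L∈Age , fs = age-JEP N M₁ M₂ (K⊆Age M₁∈K) (K⊆Age M₂∈K) in L , Age⊆K L∈Age , fs)

    Misses : Structure → Set (suc ℓ ⊔ κ)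
    Misses L = ∃ λ M → M ∈ K × ¬ Embedding M L

    ¬allMiss : K Respects _≅_ → Satisfiable K → K ⊆ FinitelyGenerated → JEP K →
      ClosedUnderUnionsOfChains K → ¬ (∀ L → L ∈ K → Misses L)
    ¬allMiss respects start K⊆FG jep unions misses =
      -- The limit is in `K`, hence finitely generated, so compactness applies to its own identity
      -- map.
      let n , limit↪Lₙ      = limit-compact (K⊆FG limit∈K) idᴱ
          _ , (M , f , M↪̸Lₙ) = extension n
      -- `M` was missed by stage `n`, yet it embeds in stage `n + 1`, thence in the limit and back
      -- into stage `n`.
      in M↪̸Lₙ (limit↪Lₙ ∘ᴱ ι (ℕ.suc n) ∘ᴱ f)
      where
      Grows : ℕ → Structure → Structure → Set (suc ℓ)
      Grows _ L L′ = ∃ λ M → Embedding M L′ × ¬ Embedding M L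

      extend : ∀ n L → L ∈ K → ∃ λ L′ → L′ ∈ K × Embedding L L′ × Grows n L L′
      extend _ L L∈K =
        let M , M∈K , M↪̸L     = misses L L∈K
            L′ , L′∈K , f , g = jep L M L∈K M∈K
        in L′ , L′∈K , f , M , g , M↪̸L

      open Iterate Grows start extend

      limit∈K : limit ∈ K
      limit∈K = unions limit _ limit-isUnionOfChain λ n →
        respects (≅-image (ι n)) (proj₂ (stage n))

    unionClosed⇒universal : ExcludedMiddle (suc ℓ ⊔ κ) →
      K Respects _≅_ → Satisfiable K → K ⊆ FinitelyGenerated → JEP K →
      ClosedUnderUnionsOfChains K → ∃ λ N → N ∈ K × (∀ M → M ∈ K → Embedding M N)
    unionClosed⇒universal em respects start K⊆FG jep unions =
      dne λ none → ¬allMiss respects start K⊆FG jep unions λ L L∈K →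
      -- If `L` misses no member of `K`, every member embeds in `L`, contradicting `none`.
      -- Embeddings live in the smaller universe `ℓ`, so they are lifted to the level of the
      -- excluded middle.
      dne λ ¬miss → none (L , L∈K , λ M M∈K → Level.lower {ℓ = suc ℓ ⊔ κ} (
      dne λ ¬f → ¬miss (M , M∈K , ¬f ∘ Level.lift)))
      where
      dne : DoubleNegationElimination (suc ℓ ⊔ κ)
      dne = em⇒dne em

theorem1 : ∀ {ℓ κ : Level} (𝐀 : ULChain ℓ) (𝓟 : Language ℓ) →
    let open Structures 𝐀 𝓟 in
    (∀ (K : Pred Structure κ) → K Respects _≅_ → Satisfiable K →
    K ⊆ FinitelyGenerated → Countable K →
    (∃ λ N → K ≐ Age N) ⇔ (HP K × JEP K))
    ×
    (ExcludedMiddle (suc ℓ ⊔ κ) →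
    ∀ (K : Pred Structure κ) → K Respects _≅_ → Satisfiable K →
    K ⊆ FinitelyGenerated → HP K → JEP K → ClosedUnderUnionsOfChains K →
    ∃ λ N → K ≐ Age N)
theorem1 𝐀 𝓟 =
  (λ K respects start K⊆FG countable →
    mk⇔ (age⇒HP×JEP K) (λ (hp , jep) → countable⇒age K respects start K⊆FG countable hp jep)) ,
  (λ em K respects start K⊆FG hp jep unions →
    let N , N∈K , universal = unionClosed⇒universal K em respects start K⊆FG jep unions
    in N , universal⇒age K respects K⊆FG hp N∈K universal)
  where open AgeProperties 𝐀 𝓟
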